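{- Let $X$ be a finitely supported subset of an invariant set $U$. (8) $\wp_{fs}(X)$ is FSM Dedekind infinite if and only if $X$ is FSM ascending infinite. (9) If $X$ is FSM Dedekind infinite, then $X$ is FSM ascending infinite; the converse fails, since $\wp_{fin}(A)$ is FSM ascending infinite but not FSM Dedekind infinite.
   Context: Framework (FSM). Work in ZF with a fixed infinite set $A$ of atoms; $S_A$ is the group of bijections of $A$ fixing all but finitely many atoms; $Fix(S)$ is the set of $\pi\in S_A$ fixing each element of $S\subseteq A$; $S$ supports $x$ if $\pi\cdot x=x$ for all $\pi\in Fix(S)$. An invariant set is an $S_A$-set all of whose elements have finite supports; subsets carry $\pi\star Z=\{\pi\cdot z:z\in Z\}$; $\wp_{fs}(X)$ is the set of subsets of $U$ contained in $X$ that are finitely supported under $\star$, and $\wp_{fin}(A)$ is the set of finite subsets of $A$. $\mathbb N$ carries the trivial action. A function is finitely supported if there is a finite $S$ such that for all $\pi\in Fix(S)$, $f(\pi\cdot x)=\pi\cdot f(x)$ and $\pi$ preserves domain and codomain. $X$ is FSM Dedekind infinite if there is a finitely supported injection from $X$ onto a finitely supported proper subset of $X$. $X$ is FSM ascending infinite if there is a sequence $(X_n)_{n\in\mathbb N}$ of finitely supported subsets of $U$ with $X_0\subseteq X_1\subseteq\cdots$, such that the map $n\mapsto X_n$ is finitely supported, $X\subseteq\bigcup_nX_n$, and there is no $n$ with $X\subseteq X_n$. -}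

module Defs where

open import Level using (Level; Lift; lift; suc; _⊔_; 0ℓ)
open import Algebra.Bundles using (Group)
open import Data.List.Base using (List; []; _∷_; _++_; map)
open import Data.List.Membership.Propositional using (_∈_; _∉_)
open import Data.List.Membership.Propositional.Properties
  using (∈-++⁺ˡ; ∈-++⁺ʳ; ∈-map⁺; ∈-map⁻)
open import Data.List.Relation.Unary.Any using (here)
open import Data.List.Relation.Unary.Enumerates.Setoid using (IsEnumeration)
open import Data.Nat.Base using (ℕ) renaming (suc to 1+_)
open import Data.Product.Base using (Σ; ∃; _×_; _,_; proj₁; proj₂)
open import Data.Unit.Polymorphic.Base using (⊤; tt)
open import Function.Base using (_∘_)
open import Function.Bundles using (Func; Injection; Bijection; Inverse; _↔_)
open import Function.Construct.Composition using (_↔-∘_)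
open import Function.Construct.Identity using (↔-id)
open import Function.Construct.Symmetry using (↔-sym)
open import Relation.Binary.Bundles using (Setoid)
import Relation.Binary.Construct.On as On
open import Relation.Binary.PropositionalEquality
  using (_≡_; refl; sym; trans; cong; setoid)
open import Relation.Nullary.Negation using (¬_)
open import Relation.Unary using (_⊆_; _⊂_; _≐_)

private
  variable
    a c e c′ e′ : Level

Infinite : Set a → Set a
Infinite A = ∀ (xs : List A) → ¬ IsEnumeration (setoid A) xs

-- Finite sets of atoms are represented by lists, up to order and repetition.
record FinPerm (A : Set a) : Set a where
  field
    perm        : A ↔ A
    finiteMoved : ∃ λ (S : List A) → ∀ {x} → x ∉ S → Inverse.to perm x ≡ x

  open Inverse perm public using (to; from)

  to-from : ∀ x → to (from x) ≡ x
  to-from = Inverse.strictlyInverseˡ perm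

  from-to : ∀ x → from (to x) ≡ x
  from-to = Inverse.strictlyInverseʳ perm

  from-fixes : ∀ {x} → to x ≡ x → from x ≡ x
  from-fixes {x} eq = trans (cong from (sym eq)) (from-to x)

FinSym : Set a → Group a a
FinSym A = record
  { Carrier = FinPerm A
  ; _≈_     = λ π σ → ∀ x → to π x ≡ to σ x
  ; _∙_     = λ π σ → record
      { perm        = perm π ↔-∘ perm σ
      ; finiteMoved = proj₁ (finiteMoved π) ++ proj₁ (finiteMoved σ) , λ x∉ →
          trans (cong (to π) (proj₂ (finiteMoved σ)
                               (x∉ ∘ ∈-++⁺ʳ (proj₁ (finiteMoved π)))))
                (proj₂ (finiteMoved π) (x∉ ∘ ∈-++⁺ˡ))
      }
  ; ε       = record { perm = ↔-id A ; finiteMoved = [] , λ _ → refl }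
  ; _⁻¹     = λ π → record
      { perm        = ↔-sym (perm π)
      ; finiteMoved = proj₁ (finiteMoved π) ,
                      λ x∉ → from-fixes π (proj₂ (finiteMoved π) x∉)
      }
  ; isGroup = record
      { isMonoid = record
          { isSemigroup = record
              { isMagma = record
                  { isEquivalence = record
                      { refl  = λ _ → refl
                      ; sym   = λ p x → sym (p x)
                      ; trans = λ p q x → trans (p x) (q x)
                      }
                  ; ∙-cong = λ {π} {_} {_} {τ} p q x →
                      trans (cong (to π) (q x)) (p (to τ x))
                  }
              ; assoc = λ _ _ _ _ → refl
              }
          ; identity = (λ _ _ → refl) , (λ _ _ → refl)
          }
      ; inverse = from-to , to-from
      ; ⁻¹-cong = λ {π} {σ} p x →
          trans (cong (from π) (trans (sym (to-from σ x)) (sym (p (from σ x)))))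
                (from-to π (from σ x))
      }
  }
  where open FinPerm

module _ {A : Set a} where

  Fix : List A → FinPerm A → Set a
  Fix S π = ∀ {x} → x ∈ S → FinPerm.to π x ≡ x

  open Group (FinSym A) using (_⁻¹)

  Fix-⁻¹ : ∀ {S} π → Fix S π → Fix S (π ⁻¹)
  Fix-⁻¹ π fix x∈S = FinPerm.from-fixes π (fix x∈S)

record PermSet (A : Set a) (c e : Level) : Set (a ⊔ suc (c ⊔ e)) where
  infixr 7 _·_
  open Group (FinSym A) using (_∙_; ε) renaming (_≈_ to _≈ₛ_)
  field
    underlying : Setoid c e
  open Setoid underlying public using (Carrier; _≈_)
  field
    _·_    : FinPerm A → Carrier → Carrier
    ·-cong : ∀ {π σ x y} → π ≈ₛ σ → x ≈ y → π · x ≈ σ · y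
    ε-·    : ∀ x → ε · x ≈ x
    ∙-·    : ∀ π σ x → (π ∙ σ) · x ≈ π · σ · x

  module Eq = Setoid underlying

  _Supports_ : List A → Carrier → Set (a ⊔ e)
  S Supports x = ∀ π → Fix S π → π · x ≈ x

  FinSupp : Carrier → Set (a ⊔ e)
  FinSupp x = ∃ λ S → S Supports x

record InvariantSet (A : Set a) (c e : Level) : Set (a ⊔ suc (c ⊔ e)) where
  field
    permSet : PermSet A c e
  open PermSet permSet public
  field
    finSupp : ∀ x → FinSupp x

module _ {A : Set a} (U : PermSet A c e) where
  open PermSet U
  open Group (FinSym A) using (_∙_; _⁻¹; inverseˡ; inverseʳ)

  ⁻¹-· : ∀ π x → (π ⁻¹) · π · x ≈ x
  ⁻¹-· π x = Eq.trans (Eq.sym (∙-· (π ⁻¹) π x))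
                      (Eq.trans (·-cong (inverseˡ π) Eq.refl) (ε-· x))

  ·-⁻¹ : ∀ π x → π · (π ⁻¹) · x ≈ x
  ·-⁻¹ π x = Eq.trans (Eq.sym (∙-· π (π ⁻¹) x))
                      (Eq.trans (·-cong (inverseʳ π) Eq.refl) (ε-· x))

  -- If S supports x then π(S) supports π · x.
  ·-finSupp : ∀ π {x} → FinSupp x → FinSupp (π · x)
  ·-finSupp π {x} (S , supp) = map (FinPerm.to π) S , λ σ fix →
    let τ = (π ⁻¹) ∙ (σ ∙ π)
        τ-fix : Fix S τ
        τ-fix {y} y∈S = trans (cong (FinPerm.from π) (fix (∈-map⁺ _ y∈S)))
                              (FinPerm.from-to π y)
    in Eq.trans (Eq.sym (·-⁻¹ π (σ · π · x)))
         (·-cong {π} (λ _ → refl)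
           (Eq.trans
             (Eq.trans (·-cong {π ⁻¹} (λ _ → refl) (Eq.sym (∙-· σ π x)))
                       (Eq.sym (∙-· (π ⁻¹) (σ ∙ π) x)))
             (supp τ τ-fix)))

-- The level of membership is fixed at c ⊔ e, the least level closed under
-- ⋆; excluded middle makes this choice immaterial.
record Subset {A : Set a} (U : PermSet A c e) : Set (suc (c ⊔ e)) where
  open PermSet U
  field
    Mem  : Carrier → Set (c ⊔ e)
    resp : ∀ {x y} → x ≈ y → Mem x → Mem y

open Subset

module _ {A : Set a} (U : PermSet A c e) where
  open PermSet U
  open Group (FinSym A) using (_∙_; _⁻¹; ε)
    renaming (sym to symₛ; _≈_ to _≈ₛ_)

  infixr 7 _⋆_

  _⋆_ : FinPerm A → Subset U → Subset U
  π ⋆ Z = record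
    { Mem  = λ y → ∃ λ z → Mem Z z × y ≈ π · z
    ; resp = λ x≈y (z , z∈Z , eq) → z , z∈Z , Eq.trans (Eq.sym x≈y) eq
    }

  private
    ⋆-mono : ∀ {π σ Y Z} → π ≈ₛ σ → Mem Y ⊆ Mem Z → Mem (π ⋆ Y) ⊆ Mem (σ ⋆ Z)
    ⋆-mono p sub (z , z∈ , eq) = z , sub z∈ , Eq.trans eq (·-cong p Eq.refl)

  ℘ : PermSet A (suc (c ⊔ e)) (c ⊔ e)
  ℘ = record
    { underlying = record
        { Carrier = Subset U
        ; _≈_     = λ Y Z → Mem Y ≐ Mem Z
        ; isEquivalence = record
            { refl  = (λ m → m) , (λ m → m)
            ; sym   = λ (p , q) → q , p
            ; trans = λ (p , q) (p′ , q′) → (λ m → p′ (p m)) , (λ m → q (q′ m))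
            }
        }
    ; _·_    = _⋆_
    ; ·-cong = λ {π} {σ} {Y} {Z} p (s , t) →
        ⋆-mono {π} {σ} {Y} {Z} p s ,
        ⋆-mono {σ} {π} {Z} {Y} (symₛ {π} {σ} p) t
    ; ε-·    = λ Z →
        (λ (z , z∈Z , eq) → resp Z (Eq.sym (Eq.trans eq (ε-· z))) z∈Z) ,
        (λ {y} y∈Z → y , y∈Z , Eq.sym (ε-· y))
    ; ∙-·    = λ π σ Z →
        (λ (z , z∈Z , eq) →
           σ · z , (z , z∈Z , Eq.refl) , Eq.trans eq (∙-· π σ z)) ,
        (λ (w , (z , z∈Z , w≈) , eq) →
           z , z∈Z , Eq.trans eq (Eq.trans (·-cong {π} (λ _ → refl) w≈)
                                           (Eq.sym (∙-· π σ z))))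
    }

  closed⇒Supports : ∀ S (Z : Subset U) →
                    (∀ π → Fix S π → ∀ {z} → Mem Z z → Mem Z (π · z)) →
                    PermSet._Supports_ ℘ S Z
  closed⇒Supports S Z closed π fix =
    (λ (z , z∈Z , eq) → resp Z (Eq.sym eq) (closed π fix z∈Z)) ,
    (λ {y} y∈Z → (π ⁻¹) · y , closed (π ⁻¹) (Fix-⁻¹ π fix) y∈Z ,
                 Eq.sym (·-⁻¹ U π y))

record FSSubset {A : Set a} (U : InvariantSet A c e) : Set (a ⊔ suc (c ⊔ e)) where
  constructor fs
  open InvariantSet U using (permSet)
  field
    subset    : Subset permSet
    supported : PermSet.FinSupp (℘ permSet) subset

open FSSubset

module _ {A : Set a} (U : InvariantSet A c e) where
  open InvariantSet U
  private module ℘ = PermSet (℘ permSet)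

  ℘fs : InvariantSet A (a ⊔ suc (c ⊔ e)) (c ⊔ e)
  ℘fs = record
    { permSet = record
        { underlying = On.setoid {B = FSSubset U} ℘.underlying subset
        ; _·_    = λ π X → fs (π ℘.· subset X) (·-finSupp (℘ permSet) π {subset X} (supported X))
        ; ·-cong = λ {π} {σ} {X} {Y} p → ℘.·-cong {π} {σ} {subset X} {subset Y} p
        ; ε-·    = λ X → ℘.ε-· (subset X)
        ; ∙-·    = λ π σ X → ℘.∙-· π σ (subset X)
        }
    ; finSupp = supported
    }

  whole : FSSubset U
  whole = fs Z ([] , closed⇒Supports permSet [] Z (λ _ _ _ → tt))
    where
    Z : Subset permSet
    Z = record { Mem = λ _ → ⊤ ; resp = λ _ _ → tt }

module _ {A : Set a} {U : InvariantSet A c e} where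
  open InvariantSet U

  ⟦_⟧ : FSSubset U → Carrier → Set (c ⊔ e)
  ⟦ X ⟧ = Mem (subset X)

  ⟨_⟩ : FSSubset U → Setoid (c ⊔ e) e
  ⟨ X ⟩ = On.setoid {B = ∃ ⟦ X ⟧} underlying proj₁

  ℘fs[_] : FSSubset U → FSSubset (℘fs U)
  ℘fs[ X ] = fs Zs (S , closed⇒Supports (InvariantSet.permSet (℘fs U)) S Zs
      (λ { π fix (lift Z⊆X) → lift λ (z , z∈Z , eq) →
             proj₁ (proj₂ (supported X) π fix) (z , Z⊆X z∈Z , eq) }))
    where
    S : List A
    S = proj₁ (supported X)

    Zs : Subset (InvariantSet.permSet (℘fs U))
    Zs = record
      { Mem  = λ Z → Lift _ (⟦ Z ⟧ ⊆ ⟦ X ⟧)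
      ; resp = λ (_ , Z⊆Y) (lift Y⊆X) → lift (λ z∈Z → Y⊆X (Z⊆Y z∈Z))
      }

module _ (A : Set a) where

  Atoms : InvariantSet A a a
  Atoms = record
    { permSet = record
        { underlying = setoid A
        ; _·_    = FinPerm.to
        ; ·-cong = λ { p refl → p _ }
        ; ε-·    = λ _ → refl
        ; ∙-·    = λ _ _ _ → refl
        }
    ; finSupp = λ x → x ∷ [] , λ _ fix → fix (here refl)
    }

  trivialℕ : InvariantSet A 0ℓ 0ℓ
  trivialℕ = record
    { permSet = record
        { underlying = setoid ℕ
        ; _·_    = λ _ n → n
        ; ·-cong = λ _ n≡m → n≡m
        ; ε-·    = λ _ → refl
        ; ∙-·    = λ _ _ _ → refl
        }
    ; finSupp = λ _ → [] , λ _ _ → refl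
    }

  ℘fin : FSSubset (℘fs Atoms)
  ℘fin = fs Zs ([] , closed⇒Supports (InvariantSet.permSet (℘fs Atoms)) [] Zs
    (λ { π _ (lift (xs , Z⊆xs , xs⊆Z)) → lift
           ( map (FinPerm.to π) xs
           , (λ { (z , z∈Z , refl) → ∈-map⁺ _ (Z⊆xs z∈Z) })
           , (λ y∈ → let (z , z∈xs , eq) = ∈-map⁻ _ y∈ in z , xs⊆Z z∈xs , eq)) }))
    where
    Zs : Subset (InvariantSet.permSet (℘fs Atoms))
    Zs = record
      { Mem  = λ Z → Lift _ (∃ λ (xs : List A) → ⟦ Z ⟧ ≐ (_∈ xs))
      ; resp = λ (Y⊆Z , Z⊆Y) (lift (xs , Y⊆xs , xs⊆Y)) → lift
          (xs , (λ z∈Z → Y⊆xs (Z⊆Y z∈Z)) , (λ x∈ → Y⊆Z (xs⊆Y x∈)))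
      }

module _ {A : Set a} {U : InvariantSet A c e} {V : InvariantSet A c′ e′}
         {X : FSSubset U} {Y : FSSubset V} where
  private
    module U = InvariantSet U
    module V = InvariantSet V

  -- The first two components say that π preserves the domain and codomain.
  _SupportsFunc_ : List A → Func ⟨ X ⟩ ⟨ Y ⟩ → Set (a ⊔ c ⊔ e ⊔ c′ ⊔ e′)
  S SupportsFunc f = ∀ π → Fix S π →
      (Mem (_⋆_ U.permSet π (subset X)) ≐ ⟦ X ⟧)
    × (Mem (_⋆_ V.permSet π (subset Y)) ≐ ⟦ Y ⟧)
    × (∀ {x} (x∈X : ⟦ X ⟧ x) (πx∈X : ⟦ X ⟧ (π U.· x)) →
         proj₁ (Func.to f (π U.· x , πx∈X)) V.≈ π V.· proj₁ (Func.to f (x , x∈X)))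

  FinSuppFunc : Func ⟨ X ⟩ ⟨ Y ⟩ → Set (a ⊔ c ⊔ e ⊔ c′ ⊔ e′)
  FinSuppFunc f = ∃ λ S → S SupportsFunc f

sequence : {A : Set a} (V : InvariantSet A c e) →
           (ℕ → InvariantSet.Carrier V) → Func ⟨ whole (trivialℕ A) ⟩ ⟨ whole V ⟩
sequence V s = record
  { to   = λ (n , _) → s n , tt
  ; cong = λ { refl → InvariantSet.Eq.refl V }
  }

module _ {A : Set a} {U : InvariantSet A c e} where

  DedekindInfinite : FSSubset U → Set (a ⊔ suc (c ⊔ e))
  DedekindInfinite X =
    ∃ λ (Z : FSSubset U) → (⟦ Z ⟧ ⊂ ⟦ X ⟧) ×
    Σ (Bijection ⟨ X ⟩ ⟨ Z ⟩) λ f →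
      FinSuppFunc {X = X} {Y = Z} (Injection.function (Bijection.injection f))

  AscendingInfinite : FSSubset U → Set (a ⊔ suc (c ⊔ e))
  AscendingInfinite X =
    ∃ λ (Xₙ : ℕ → FSSubset U) →
        FinSuppFunc {X = whole (trivialℕ A)} {Y = whole (℘fs U)} (sequence (℘fs U) Xₙ)
      × (∀ n → ⟦ Xₙ n ⟧ ⊆ ⟦ Xₙ (1+ n) ⟧)
      × (∀ {x} → ⟦ X ⟧ x → ∃ λ n → ⟦ Xₙ n ⟧ x)
      × (∀ n → ¬ (⟦ X ⟧ ⊆ ⟦ Xₙ n ⟧))

{-# OPTIONS --safe #-}

-- A Dedekind infinite set contains an injective sequence all of whose terms
-- have one common finite support: iterate the injection on a point outside its
-- image.  Conversely such a sequence can be shifted by one.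
--
-- For (8), let (Zₙ) be such a sequence of subsets of X.  The traces x ↦ (x ∈ Zₙ)ₙ
-- form an infinite subset of Cantor space, so they accumulate at some t; the
-- sets of those x whose trace first leaves t before stage n, or equals t,
-- ascend to X without ever reaching it.  Since t depends on the Zₙ alone, these
-- sets inherit the common support.  Conversely, an ascending sequence that never
-- reaches X has a subsequence whose intersections with X strictly increase.
--
-- For (9), a finite set of atoms is contained in each of its supports, hence
-- only finitely many finite sets share a given support.

module Submission where

open import Algebra.Bundles using (Group)
open import Axiom.ExcludedMiddle using (ExcludedMiddle)
open import Data.Empty using (⊥-elim)
open import Data.Fin.Base as Fin using (Fin; toℕ; combine)
open import Data.Fin.Properties using (pigeonhole; combine-injective; injective⇒≤)
open import Data.List.Base using (List; []; _∷_; _++_; map; length; lookup)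
open import Data.List.Membership.Propositional using (_∈_; _∉_)
open import Data.List.Membership.Propositional.Properties
  using (∈-++⁺ˡ; ∈-++⁺ʳ; ∈-map⁺; ∈-map⁻; ∈-lookup)
open import Data.List.Properties using (length-map)
open import Data.List.Relation.Unary.All as All using ()
open import Data.List.Relation.Unary.All.Properties using (¬Any⇒All¬)
open import Data.List.Relation.Unary.Any using (here; there; index)
open import Data.List.Relation.Unary.Any.Properties using (lookup-index)
open import Data.List.Relation.Unary.AllPairs using ([]; _∷_)
open import Data.List.Relation.Unary.Unique.Propositional using (Unique)
open import Data.Nat.Base using (ℕ; zero; suc; _*_; _≤_; _<_; _≤′_; ≤′-refl; ≤′-step)
open import Data.Nat.Properties
  using (1+n≢0; ≤-refl; ≤-trans; <-irrefl; n<1+n; m≤n⇒m≤1+n; ≤-total; <-cmp; ≤⇒≤′)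
open import Data.Product.Base using (Σ; ∃; ∃₂; _×_; _,_; proj₁; proj₂)
open import Data.Sum.Base using (_⊎_; inj₁; inj₂)
open import Data.Unit.Polymorphic.Base using (tt)
open import Function.Base using (_∘_)
open import Function.Bundles using (_⇔_; mk⇔; mk↔ₛ′; Equivalence; Bijection)
open import Function.Construct.Symmetry using (⇔-sym)
open import Level using (Level; Setω; Lift; lift; lower; _⊔_) renaming (suc to lsuc)
open import Relation.Binary.Definitions using (DecidableEquality; tri<; tri≈; tri>)
open import Relation.Binary.PropositionalEquality
  using (_≡_; _≢_; refl; sym; trans; cong; subst)
open import Relation.Nullary.Decidable using (Dec; yes; no; decidable-stable)
open import Relation.Nullary.Negation using (¬_; contradiction)
open import Relation.Unary using (Pred; _⊆_; _∪_; _∩_; ∁; _≐_)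
open import Defs

open FSSubset
open Subset

private
  variable
    a c e ℓ ℓ₁ ℓ₂ : Level

EM : Setω
EM = ∀ {ℓ} → ExcludedMiddle ℓ

⊈⇒∃ : EM → {C : Set c} {P : Pred C ℓ₁} {Q : Pred C ℓ₂} →
      ¬ (P ⊆ Q) → ∃ λ x → P x × ¬ Q x
⊈⇒∃ em P⊈Q = decidable-stable em λ ∄ →
  P⊈Q λ x∈P → decidable-stable em λ x∉Q → ∄ (_ , x∈P , x∉Q)

-- Traces of a sequence of sets

module Traces {C : Set c} (Z : ℕ → Pred C ℓ) where

  -- The colouring of indices encodes that `Z n ∩ P` takes finitely many values; exchanging `m` and
  -- `n` turns the inclusion into an equality.
  FinitelyManyTraces : Pred C ℓ₁ → Set _
  FinitelyManyTraces P = ∃ λ k → Σ (ℕ → Fin k) λ colour →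
    ∀ m n → colour m ≡ colour n → ∀ {x} → P x → Z m x → Z n x

  antitone : {P : Pred C ℓ₁} {Q : Pred C ℓ₂} → P ⊆ Q →
             FinitelyManyTraces Q → FinitelyManyTraces P
  antitone P⊆Q (k , colour , same) =
    k , colour , λ m n eq x∈P → same m n eq (P⊆Q x∈P)

  -- Indices are coloured by pairs: a point of the union needs only the coordinate of the part it
  -- lies in.
  ∪-traces : {P : Pred C ℓ₁} {Q : Pred C ℓ₂} →
             FinitelyManyTraces P → FinitelyManyTraces Q →
             FinitelyManyTraces (P ∪ Q)
  ∪-traces (k , f , f-same) (l , g , g-same) =
    k * l , (λ n → combine (f n) (g n)) , λ m n eq →
      let (f≡ , g≡) = combine-injective (f m) (g m) (f n) (g n) eq
      in λ { (inj₁ x∈P) → f-same m n f≡ x∈P ; (inj₂ x∈Q) → g-same m n g≡ x∈Q }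

  Homogeneous : Pred C ℓ₁ → ℕ → Set _
  Homogeneous P n = (P ⊆ Z n) ⊎ (P ⊆ ∁ (Z n))

  homogeneous-⊆ : ∀ {P : Pred C ℓ₁} {Q : Pred C ℓ₂} n → P ⊆ Q →
                  Homogeneous Q n → Homogeneous P n
  homogeneous-⊆ n P⊆Q (inj₁ Q⊆Z)  = inj₁ λ x∈P → Q⊆Z (P⊆Q x∈P)
  homogeneous-⊆ n P⊆Q (inj₂ Q⊆∁Z) = inj₂ λ x∈P → Q⊆∁Z (P⊆Q x∈P)

  homogeneous-traces : {P : Pred C ℓ₁} → (∀ n → Homogeneous P n) →
                       FinitelyManyTraces P
  homogeneous-traces {P = P} hom = 2 , (λ n → side (hom n)) , λ m n →
      side-same (hom m) (hom n)
    where
    side : ∀ {n} → Homogeneous P n → Fin 2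
    side (inj₁ _) = Fin.zero
    side (inj₂ _) = Fin.suc Fin.zero

    side-same : ∀ {m n} (h : Homogeneous P m) (h′ : Homogeneous P n) →
                side h ≡ side h′ → ∀ {x} → P x → Z m x → Z n x
    side-same _        (inj₁ P⊆)  _ x∈P _ = P⊆ x∈P
    side-same (inj₂ P⊆∁) (inj₂ _) _ x∈P x∈Z = contradiction x∈Z (P⊆∁ x∈P)

  -- Among `k + 1` indices two share a colour, and sets contained in `P` are determined by their
  -- traces on `P`.
  traces-repeat : {P : Pred C ℓ₁} → (∀ n → Z n ⊆ P) → FinitelyManyTraces P →
                  ∃₂ λ m n → m < n × Z m ≐ Z n
  traces-repeat Z⊆P (k , colour , same) =
    let (i , j , i<j , eq) = pigeonhole (n<1+n k) (colour ∘ toℕ)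
    in toℕ i , toℕ j , i<j
     , (λ x∈ → same _ _ eq (Z⊆P _ x∈) x∈)
     , (λ x∈ → same _ _ (sym eq) (Z⊆P _ x∈) x∈)

  module Accumulation (em : EM) (P : Pred C ℓ) (inf : ¬ FinitelyManyTraces P) where

    -- The half inside `Z n` is kept unless it carries only finitely many traces. The rule looks at
    -- whole sets and never at a chosen point.
    branch : (Q : Pred C ℓ) (n : ℕ) → Dec (FinitelyManyTraces (Q ∩ Z n)) → Pred C ℓ
    branch Q n (yes _) = Q ∩ ∁ (Z n)
    branch Q n (no  _) = Q ∩ Z n

    -- The halves kept by `branch` spell out the limit trace; `Cell n` is the part of `P` that
    -- agrees with it at all indices below `n`.
    Cell : ℕ → Pred C ℓ
    Cell zero    = P
    Cell (suc n) = branch (Cell n) n em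

    branch-⊆ : ∀ Q n d → branch Q n d ⊆ Q
    branch-⊆ Q n (yes _) = proj₁
    branch-⊆ Q n (no  _) = proj₁

    branch-homogeneous : ∀ Q n d → Homogeneous (branch Q n d) n
    branch-homogeneous Q n (yes _) = inj₂ proj₂
    branch-homogeneous Q n (no  _) = inj₁ proj₂

    -- If the discarded and the kept half both had finitely many traces, `∪-traces` would give the
    -- same for `Q`.
    branch-infinite : ∀ Q n d → ¬ FinitelyManyTraces Q →
                      ¬ FinitelyManyTraces (branch Q n d)
    branch-infinite Q n (yes fin) Q-inf fin′ =
      Q-inf (antitone split (∪-traces fin fin′))
      where
      split : Q ⊆ (Q ∩ Z n) ∪ (Q ∩ ∁ (Z n))
      split {x} x∈Q with em {P = Z n x}
      ... | yes x∈Z = inj₁ (x∈Q , x∈Z)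
      ... | no  x∉Z = inj₂ (x∈Q , x∉Z)
    branch-infinite Q n (no inf) _ = inf

    Cell-infinite : ∀ n → ¬ FinitelyManyTraces (Cell n)
    Cell-infinite zero    = inf
    Cell-infinite (suc n) = branch-infinite (Cell n) n em (Cell-infinite n)

    Cell-⊆ : ∀ n → Cell n ⊆ P
    Cell-⊆ zero    = λ x∈P → x∈P
    Cell-⊆ (suc n) = Cell-⊆ n ∘ branch-⊆ (Cell n) n em

    -- Points with the limit trace never leave the cells, so the second alternative puts them into
    -- every stage; otherwise the stages would not cover them.
    Stage : ℕ → Pred C ℓ
    Stage n x = ¬ Cell n x ⊎ (∀ m → Cell m x)

    Stage-mono : ∀ n → Stage n ⊆ Stage (suc n)
    Stage-mono n (inj₁ x∉) = inj₁ (x∉ ∘ branch-⊆ (Cell n) n em)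
    Stage-mono n (inj₂ x∈) = inj₂ x∈

    Stage-covers : ∀ x → ∃ λ n → Stage n x
    Stage-covers x with em {P = ∃ λ n → ¬ Cell n x}
    ... | yes (n , x∉) = n , inj₁ x∉
    ... | no  ∄        = zero , inj₂ λ m → decidable-stable em λ x∉ → ∄ (m , x∉)

    -- If P ⊆ Stage n then every point of Cell n has the limit trace, so that every Z m is
    -- homogeneous on Cell n.
    Stage-proper : ∀ n → ¬ (P ⊆ Stage n)
    Stage-proper n P⊆ = Cell-infinite n (homogeneous-traces λ m →
        homogeneous-⊆ m (limit (suc m)) (branch-homogeneous (Cell m) m em))
      where
      limit : ∀ m → Cell n ⊆ Cell m
      limit m x∈ with P⊆ (Cell-⊆ n x∈)
      ... | inj₁ x∉    = contradiction x∈ x∉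
      ... | inj₂ x∈all = x∈all m

    -- Cells and stages are built from `P` and the `Z n` alone, hence respect this relation. It will
    -- be applied to equal points, and to a point and its image under a permutation fixing the
    -- common support.
    _∼_ : C → C → Set _
    x ∼ y = (P x ⇔ P y) × (∀ n → Z n x ⇔ Z n y)

    ∼-sym : ∀ {x y} → x ∼ y → y ∼ x
    ∼-sym (p , z) = ⇔-sym p , λ n → ⇔-sym (z n)

    Cell-resp : ∀ {x y} → x ∼ y → ∀ n → Cell n x → Cell n y
    Cell-resp (p , _) zero = Equivalence.to p
    -- One decision serves both points, since it concerns `Cell n` and not the point.
    Cell-resp {x} {y} x∼y (suc n) = branch-resp em
      where
      branch-resp : ∀ d → branch (Cell n) n d x → branch (Cell n) n d y
      branch-resp (yes _) (x∈ , x∉Z) =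
        Cell-resp x∼y n x∈ , x∉Z ∘ Equivalence.from (proj₂ x∼y n)
      branch-resp (no _) (x∈ , x∈Z) =
        Cell-resp x∼y n x∈ , Equivalence.to (proj₂ x∼y n) x∈Z

    Stage-resp : ∀ {x y} → x ∼ y → ∀ n → Stage n x → Stage n y
    Stage-resp x∼y n (inj₁ x∉) = inj₁ (x∉ ∘ Cell-resp (∼-sym x∼y) n)
    Stage-resp x∼y n (inj₂ x∈) = inj₂ λ m → Cell-resp x∼y m (x∈ m)

-- Uniformly supported sequences

module _ {A : Set a} (U : PermSet A c e) where
  open PermSet U

  -- For subsets this is equivalent to being supported by `S`, because `Fix S` contains inverses.
  Closed : List A → Pred Carrier ℓ → Set _
  Closed S P = ∀ π → Fix S π → ∀ {x} → P x → P (π · x)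

  Supports⇒closed : ∀ S (Z : Subset U) → PermSet._Supports_ (℘ U) S Z →
                    Closed S (Mem Z)
  Supports⇒closed S Z supp π fix {x} x∈Z =
    proj₁ (supp π fix) (x , x∈Z , Eq.refl)

  closed⇒⇔ : ∀ {S} (Z : Subset U) → Closed S (Mem Z) →
             ∀ π → Fix S π → ∀ x → Mem Z x ⇔ Mem Z (π · x)
  closed⇒⇔ Z closed π fix x = mk⇔ (closed π fix) λ πx∈Z →
    resp Z (⁻¹-· U π x) (closed (π ⁻¹) (Fix-⁻¹ π fix) πx∈Z)
    where open Group (FinSym A) using (_⁻¹)

  ·-congˡ : ∀ π {x y} → x ≈ y → π · x ≈ π · y
  ·-congˡ π = ·-cong {π} {π} (λ _ → refl)

  ≈-fixed : ∀ π {x z} → π · z ≈ z → x ≈ z → π · x ≈ z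
  ≈-fixed π πz≈z x≈z = Eq.trans (·-congˡ π x≈z) πz≈z

  ≈-fixed⁻ : ∀ π {x z} → π · z ≈ z → π · x ≈ z → x ≈ z
  ≈-fixed⁻ π {x} {z} πz≈z πx≈z = Eq.trans (Eq.sym (⁻¹-· U π x))
    (Eq.trans (·-congˡ (π ⁻¹) (Eq.trans πx≈z (Eq.sym πz≈z))) (⁻¹-· U π z))
    where open Group (FinSym A) using (_⁻¹)

module _ {A : Set a} {U : InvariantSet A c e} where
  open InvariantSet U

  closed⇒FSSubset : ∀ S (Z : Subset permSet) → Closed permSet S (Mem Z) → FSSubset U
  closed⇒FSSubset S Z closed = fs Z (S , closed⇒Supports permSet S Z closed)

  -- As ℕ carries the trivial action, equivariance of `term` under `Fix support` amounts to
  -- `support` supporting every term.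
  record UniformSequence (X : FSSubset U) : Set (a ⊔ c ⊔ e) where
    field
      term      : ℕ → Carrier
      term∈     : ∀ n → ⟦ X ⟧ (term n)
      injective : ∀ m n → term m ≈ term n → m ≡ n
      support   : List A
      supports  : ∀ n → support Supports term n

  uniform⇒ascending : (X : FSSubset U) (Xₙ : ℕ → Subset permSet) (S : List A) →
    (∀ n → Closed permSet S (Mem (Xₙ n))) →
    (∀ n → Mem (Xₙ n) ⊆ Mem (Xₙ (suc n))) →
    (∀ {x} → ⟦ X ⟧ x → ∃ λ n → Mem (Xₙ n) x) →
    (∀ n → ¬ (⟦ X ⟧ ⊆ Mem (Xₙ n))) →
    AscendingInfinite X
  uniform⇒ascending X Xₙ S closed mono covers proper =
      Yₙ
    , (S , λ π fix →
          ((λ _ → tt) , (λ {n} _ → n , tt , refl))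
        , ((λ _ → tt)
          , (λ {Z} _ → (π ⁻¹) ℘fs.· Z , tt ,
               ℘fs.Eq.sym {π ℘fs.· (π ⁻¹) ℘fs.· Z} {Z} (·-⁻¹ ℘fs.permSet π Z)))
        -- `π` acts trivially on `n`, so equivariance asks that `Xₙ n` equal its own image: the
        -- support property read backwards.
        , λ {n} _ _ → let (p , q) = supported′ n π fix in q , p)
    , mono , covers , proper
    where
    module ℘fs = InvariantSet (℘fs U)
    open Group (FinSym A) using (_⁻¹)

    Yₙ : ℕ → FSSubset U
    Yₙ n = closed⇒FSSubset S (Xₙ n) (closed n)

    supported′ : ∀ n → PermSet._Supports_ (℘ permSet) S (Xₙ n)
    supported′ n = closed⇒Supports permSet S (Xₙ n) (closed n)

  dedekind⇒sequence : EM → (X : FSSubset U) → DedekindInfinite X → UniformSequence X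
  dedekind⇒sequence em X (Z , (Z⊆X , X⊈Z) , f , S , f-supp) = record
    { term      = λ n → proj₁ (iterate n)
    ; term∈     = λ n → proj₂ (iterate n)
    ; injective = iterate-injective
    ; support   = S ++ proj₁ (finSupp x₀)
    ; supports  = iterate-supp
    }
    where
    open Bijection f using (to) renaming (cong to f-cong; injective to f-injective)

    missed : ∃ λ x → ⟦ X ⟧ x × ¬ ⟦ Z ⟧ x
    missed = ⊈⇒∃ em X⊈Z

    x₀ : Carrier
    x₀ = proj₁ missed

    iterate : ℕ → ∃ ⟦ X ⟧
    iterate zero    = x₀ , proj₁ (proj₂ missed)
    iterate (suc n) = proj₁ (to (iterate n)) , Z⊆X (proj₂ (to (iterate n)))

    x₀≉to : ∀ x → ¬ x₀ ≈ proj₁ (to x)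
    x₀≉to x eq = proj₂ (proj₂ missed) (resp (subset Z) (Eq.sym eq) (proj₂ (to x)))

    iterate-injective : ∀ m n → proj₁ (iterate m) ≈ proj₁ (iterate n) → m ≡ n
    iterate-injective zero    zero    _  = refl
    iterate-injective zero    (suc n) eq = ⊥-elim (x₀≉to (iterate n) eq)
    iterate-injective (suc m) zero    eq = ⊥-elim (x₀≉to (iterate m) (Eq.sym eq))
    iterate-injective (suc m) (suc n) eq = cong suc (iterate-injective m n (f-injective eq))

    -- If `π` fixes `x` and commutes with the injection, it fixes the image of `x`; the support of
    -- `x₀` starts the induction.
    iterate-supp : ∀ n → (S ++ proj₁ (finSupp x₀)) Supports proj₁ (iterate n)
    iterate-supp zero    π fix = proj₂ (finSupp x₀) π (fix ∘ ∈-++⁺ʳ S)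
    iterate-supp (suc n) π fix =
      let (πX≐X , _ , commutes) = f-supp π (fix ∘ ∈-++⁺ˡ)
          (x , x∈X) = iterate n
          πx∈X = proj₁ πX≐X (x , x∈X , Eq.refl)
      in Eq.trans (Eq.sym (commutes x∈X πx∈X)) (f-cong (iterate-supp n π fix))

  -- The injection shifts the sequence and fixes every other element.
  sequence⇒dedekind : EM → (X : FSSubset U) → UniformSequence X → DedekindInfinite X
  sequence⇒dedekind em X s =
      Z
    , (proj₁ , λ X⊆Z → proj₂ (X⊆Z (term∈ 0)) Eq.refl)
    , record
        { to        = shift′
        ; cong      = shift-cong em em
        ; bijective = shift-injective em em , λ w → preimage w em
        }
    , S , λ π fix →
          proj₂ (supported X) π (fix ∘ ∈-++⁺ʳ support)
        , closed⇒Supports permSet S (subset Z) Z-closed π fix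
        , λ {x} _ _ → shift-equivariant π fix x em em
    where
    open UniformSequence s

    S : List A
    S = support ++ proj₁ (supported X)

    term-fixed : ∀ π → Fix S π → ∀ n → π · term n ≈ term n
    term-fixed π fix n = supports n π (fix ∘ ∈-++⁺ˡ)

    Z-closed : Closed permSet S (λ x → ⟦ X ⟧ x × ¬ x ≈ term 0)
    Z-closed π fix (x∈X , x≉) =
        Supports⇒closed permSet _ (subset X) (proj₂ (supported X)) π
          (fix ∘ ∈-++⁺ʳ support) x∈X
      , x≉ ∘ ≈-fixed⁻ permSet π (term-fixed π fix 0)

    Z : FSSubset U
    Z = closed⇒FSSubset S
      (record { Mem  = λ x → ⟦ X ⟧ x × ¬ x ≈ term 0
              ; resp = λ x≈y (x∈X , x≉) → resp (subset X) x≈y x∈X , x≉ ∘ Eq.trans x≈y })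
      Z-closed

    IsTerm : Carrier → Set e
    IsTerm x = ∃ λ n → x ≈ term n

    -- The decision is a parameter because `em` is called at different but `≈`-related points;
    -- injectivity of `term` makes the results agree.
    shift : ∀ x → Dec (IsTerm x) → Carrier
    shift x (yes (n , _)) = term (suc n)
    shift x (no _)        = x

    shift-term : ∀ {x n} d → x ≈ term n → shift x d ≈ term (suc n)
    shift-term {n = n} (yes (m , x≈m)) x≈n =
      Eq.reflexive (cong (term ∘ suc) (injective m n (Eq.trans (Eq.sym x≈m) x≈n)))
    shift-term (no ∄) x≈n = contradiction (_ , x≈n) ∄

    shift-other : ∀ {x} d → ¬ IsTerm x → shift x d ≈ x
    shift-other (yes t) ∄ = contradiction t ∄
    shift-other (no _)  _ = Eq.refl

    shift∈Z : ∀ {x} d → ⟦ X ⟧ x → ⟦ Z ⟧ (shift x d)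
    shift∈Z (yes (n , _)) _ = term∈ (suc n) , 1+n≢0 ∘ injective (suc n) 0
    shift∈Z (no ∄) x∈X = x∈X , λ eq → ∄ (0 , eq)

    shift′ : ∃ ⟦ X ⟧ → ∃ ⟦ Z ⟧
    shift′ (x , x∈X) = shift x em , shift∈Z em x∈X

    shift-cong : ∀ {x y} d d′ → x ≈ y → shift x d ≈ shift y d′
    shift-cong d (yes (n , y≈n)) x≈y = shift-term d (Eq.trans x≈y y≈n)
    shift-cong d (no ∄) x≈y =
      Eq.trans (shift-other d λ (n , x≈n) → ∄ (n , Eq.trans (Eq.sym x≈y) x≈n)) x≈y

    shift-injective : ∀ {x y} d d′ → shift x d ≈ shift y d′ → x ≈ y
    shift-injective (yes (m , x≈m)) (yes (n , y≈n)) eq with injective _ _ eq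
    ... | refl = Eq.trans x≈m (Eq.sym y≈n)
    shift-injective (yes (m , _)) (no ∄) eq = contradiction (_ , Eq.sym eq) ∄
    shift-injective (no ∄) (yes (n , _)) eq = contradiction (_ , eq) ∄
    shift-injective (no _) (no _) eq = eq

    preimage : (w : ∃ ⟦ Z ⟧) → Dec (IsTerm (proj₁ w)) →
               ∃ λ x → ∀ {y} → proj₁ y ≈ proj₁ x → proj₁ (shift′ y) ≈ proj₁ w
    -- `term 0` is exactly what `Z` leaves out, so it needs no preimage.
    preimage (w , _ , w≉) (yes (zero  , w≈)) = contradiction w≈ w≉
    preimage (w , _ , _)  (yes (suc n , w≈)) =
      (term n , term∈ n) , λ y≈ → Eq.trans (shift-term em y≈) (Eq.sym w≈)
    preimage (w , w∈X , _) (no ∄) =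
      (w , w∈X) , λ y≈w →
        Eq.trans (shift-other em λ (n , y≈n) → ∄ (n , Eq.trans (Eq.sym y≈w) y≈n)) y≈w

    -- `π` fixes every term, so `x` and `π · x` are the same term or both are none.
    shift-equivariant : ∀ π → Fix S π → ∀ x d d′ → shift (π · x) d ≈ π · shift x d′
    shift-equivariant π fix x d (yes (n , x≈n)) =
      Eq.trans (shift-term d (≈-fixed permSet π (term-fixed π fix n) x≈n))
               (Eq.sym (term-fixed π fix (suc n)))
    shift-equivariant π fix x d (no ∄) =
      shift-other d λ (n , πx≈n) → ∄ (n , ≈-fixed⁻ permSet π (term-fixed π fix n) πx≈n)

  -- Stage `n` omits just the terms of index at least `n`: `term n` shows that it misses part of
  -- `X`, and each point omitted at first enters right after its index.
  sequence⇒ascending : EM → (X : FSSubset U) → UniformSequence X → AscendingInfinite X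
  sequence⇒ascending em X s = uniform⇒ascending X Xₙ support
      (λ n π fix (lift bound) → lift λ m πx≈m →
         bound m (≈-fixed⁻ permSet π (supports m π fix) πx≈m))
      (λ n (lift bound) → lift λ m x≈m → m≤n⇒m≤1+n (bound m x≈m))
      (λ _ → covers em)
      (λ n X⊆ → <-irrefl refl (lower (X⊆ (term∈ n)) n Eq.refl))
    where
    open UniformSequence s

    Xₙ : ℕ → Subset permSet
    Xₙ n = record
      { Mem  = λ x → Lift c (∀ m → x ≈ term m → m < n)
      ; resp = λ x≈y (lift bound) → lift λ m y≈m → bound m (Eq.trans x≈y y≈m)
      }

    covers : ∀ {x} → Dec (∃ λ m → x ≈ term m) → ∃ λ n → Mem (Xₙ n) x
    covers (yes (m , x≈m)) = suc m , lift λ k x≈k →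
      subst (_< suc m) (injective m k (Eq.trans (Eq.sym x≈m) x≈k)) ≤-refl
    covers (no ∄) = 0 , lift λ m x≈m → contradiction (m , x≈m) ∄

-- Injective sequences of subsets and ascending sequences

module _ (em : EM) {A : Set a} {U : InvariantSet A c e} (X : FSSubset U) where
  open InvariantSet U

  subsets⇒ascending : UniformSequence ℘fs[ X ] → AscendingInfinite X
  subsets⇒ascending s = uniform⇒ascending X Xₙ S
      (λ n π fix {x} → Stage-resp (moved π fix x) n)
      Stage-mono (λ {x} _ → Stage-covers x) Stage-proper
    where
    open UniformSequence s

    S : List A
    S = support ++ proj₁ (supported X)

    Z : ℕ → Pred Carrier (c ⊔ e)
    Z n = ⟦ term n ⟧

    open Traces Z

    -- The terms are subsets of `X`, so a repeated trace on `X` would be a repeated term.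
    X-infinite : ¬ FinitelyManyTraces ⟦ X ⟧
    X-infinite fin =
      let (m , n , m<n , Zm≐Zn) = traces-repeat (λ n → lower (term∈ n)) fin
      in <-irrefl (injective m n Zm≐Zn) m<n

    open Accumulation em ⟦ X ⟧ X-infinite

    -- This is what lets each stage inherit the support `S`, through `Stage-resp`.
    moved : ∀ π → Fix S π → ∀ x → x ∼ (π · x)
    moved π fix x =
        closed⇒⇔ permSet (subset X)
          (Supports⇒closed permSet _ (subset X) (proj₂ (supported X)))
          π (fix ∘ ∈-++⁺ʳ support) x
      , λ n → closed⇒⇔ permSet (subset (term n))
          (Supports⇒closed permSet _ (subset (term n)) (supports n))
          π (fix ∘ ∈-++⁺ˡ) x

    equal : ∀ {x y} → x ≈ y → x ∼ y
    equal x≈y =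
        mk⇔ (resp (subset X) x≈y) (resp (subset X) (Eq.sym x≈y))
      , λ n → mk⇔ (resp (subset (term n)) x≈y) (resp (subset (term n)) (Eq.sym x≈y))

    Xₙ : ℕ → Subset permSet
    Xₙ n = record { Mem = Stage n ; resp = λ x≈y → Stage-resp (equal x≈y) n }

  ascending⇒subsets : AscendingInfinite X → UniformSequence ℘fs[ X ]
  ascending⇒subsets (Xₙ , (S , supp) , mono , covers , proper) = record
    { term      = λ j → closed⇒FSSubset T (meet j) (meet-closed j)
    ; term∈     = λ j → lift proj₁
    ; injective = meet-injective
    ; support   = T
    ; supports  = λ j → closed⇒Supports permSet T (meet j) (meet-closed j)
    }
    where
    T : List A
    T = S ++ proj₁ (supported X)

    mono-≤′ : ∀ {m n} → m ≤′ n → ⟦ Xₙ m ⟧ ⊆ ⟦ Xₙ n ⟧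
    mono-≤′ ≤′-refl        x∈ = x∈
    mono-≤′ (≤′-step m≤′n) x∈ = mono _ (mono-≤′ m≤′n x∈)

    mono-≤ : ∀ {m n} → m ≤ n → ⟦ Xₙ m ⟧ ⊆ ⟦ Xₙ n ⟧
    mono-≤ m≤n = mono-≤′ (≤⇒≤′ m≤n)

    escapee : ∀ n → ∃ λ x → ⟦ X ⟧ x × ¬ ⟦ Xₙ n ⟧ x
    escapee n = ⊈⇒∃ em (proper n)

    -- Each new index is one that catches a point of `X` missed at the previous index.
    stage : ℕ → ℕ
    stage zero    = zero
    stage (suc j) = proj₁ (covers (proj₁ (proj₂ (escapee (stage j)))))

    meet : ℕ → Subset permSet
    meet j = record
      { Mem  = ⟦ X ⟧ ∩ ⟦ Xₙ (stage j) ⟧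
      ; resp = λ x≈y (x∈X , x∈Xₙ) →
          resp (subset X) x≈y x∈X , resp (subset (Xₙ (stage j))) x≈y x∈Xₙ
      }

    meet-closed : ∀ j → Closed permSet T (Mem (meet j))
    meet-closed j π fix {x} (x∈X , x∈Xₙ) =
        Supports⇒closed permSet _ (subset X) (proj₂ (supported X)) π
          (fix ∘ ∈-++⁺ʳ S) x∈X
      -- Since `π` fixes the index, equivariance of the sequence says that `S` supports each `Xₙ n`.
      , proj₂ (proj₂ (proj₂ (supp π (fix ∘ ∈-++⁺ˡ))) {stage j} tt tt)
          (x , x∈Xₙ , Eq.refl)

    -- Were the new index smaller, monotonicity would put the escapee into the very set it escapes.
    stage-≤ : ∀ j → stage j ≤ stage (suc j)
    stage-≤ j with ≤-total (stage j) (stage (suc j))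
    ... | inj₁ ≤ = ≤
    ... | inj₂ ≥ = let (_ , x∈X , x∉) = escapee (stage j)
                   in contradiction (mono-≤ ≥ (proj₂ (covers x∈X))) x∉

    stage-mono : ∀ {i j} → i ≤′ j → stage i ≤ stage j
    stage-mono ≤′-refl        = ≤-refl
    stage-mono (≤′-step {n} i≤′j) = ≤-trans (stage-mono i≤′j) (stage-≤ n)

    -- The escapee of `stage i` is caught at `stage (suc i)`, hence also at `stage j`.
    meet-strict : ∀ {i j} → i < j → ¬ (Mem (meet j) ⊆ Mem (meet i))
    meet-strict {i} i<j j⊆i =
      let (_ , x∈X , x∉) = escapee (stage i)
      in x∉ (proj₂ (j⊆i (x∈X , mono-≤ (stage-mono {suc i} (≤⇒≤′ i<j)) (proj₂ (covers x∈X)))))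

    meet-injective : ∀ i j → Mem (meet i) ≐ Mem (meet j) → i ≡ j
    meet-injective i j (i⊆j , j⊆i) with <-cmp i j
    ... | tri< i<j _ _ = ⊥-elim (meet-strict i<j j⊆i)
    ... | tri≈ _ i≡j _ = i≡j
    ... | tri> _ _ j<i = ⊥-elim (meet-strict j<i i⊆j)

-- Finite sets of atoms

lookup-injective : {A : Set a} {xs : List A} → Unique xs →
                   ∀ i j → lookup xs i ≡ lookup xs j → i ≡ j
lookup-injective (_ ∷ _)  Fin.zero    Fin.zero    _  = refl
lookup-injective (x∉ ∷ _) Fin.zero    (Fin.suc j) eq = contradiction eq (All.lookup x∉ (∈-lookup j))
lookup-injective (x∉ ∷ _) (Fin.suc i) Fin.zero    eq = contradiction (sym eq) (All.lookup x∉ (∈-lookup i))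
lookup-injective (_ ∷ u)  (Fin.suc i) (Fin.suc j) eq = cong Fin.suc (lookup-injective u i j eq)

-- Each position of `xs` is sent to a position of the same entry in `ys`; reading the entry back
-- shows injectivity.
unique-⊆⇒length-≤ : {A : Set a} {xs ys : List A} → Unique xs →
                    (_∈ xs) ⊆ (_∈ ys) → length xs ≤ length ys
unique-⊆⇒length-≤ {xs = xs} {ys} u xs⊆ys = injective⇒≤ {f = position} λ {i} {j} eq →
    lookup-injective u i j
      (trans (lookup-index (xs⊆ys (∈-lookup i)))
             (trans (cong (lookup ys) eq) (sym (lookup-index (xs⊆ys (∈-lookup j))))))
  where
  position : Fin (length xs) → Fin (length ys)
  position i = index (xs⊆ys (∈-lookup i))

module _ {A : Set a} (_≟_ : DecidableEquality A) where

  transpose : A → A → A → A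
  transpose x y z with z ≟ x | z ≟ y
  ... | yes _ | _     = y
  ... | no _  | yes _ = x
  ... | no _  | no _  = z

  transpose-left : ∀ x y → transpose x y x ≡ y
  transpose-left x y with x ≟ x
  ... | yes _ = refl
  ... | no x≢x = contradiction refl x≢x

  transpose-right : ∀ x y → transpose x y y ≡ x
  transpose-right x y with y ≟ x | y ≟ y
  ... | yes y≡x | _      = y≡x
  ... | no _    | yes _  = refl
  ... | no _    | no y≢y = contradiction refl y≢y

  transpose-other : ∀ {x y z} → z ≢ x → z ≢ y → transpose x y z ≡ z
  transpose-other {x} {y} {z} z≢x z≢y with z ≟ x | z ≟ y
  ... | yes z≡x | _       = contradiction z≡x z≢x
  ... | no _    | yes z≡y = contradiction z≡y z≢y
  ... | no _    | no _    = refl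

  transpose-involutive : ∀ x y z → transpose x y (transpose x y z) ≡ z
  transpose-involutive x y z = by (z ≟ x) (z ≟ y)
    where
    by : Dec (z ≡ x) → Dec (z ≡ y) → transpose x y (transpose x y z) ≡ z
    by (yes refl) _ = trans (cong (transpose x y) (transpose-left x y)) (transpose-right x y)
    by (no _) (yes refl) = trans (cong (transpose x y) (transpose-right x y)) (transpose-left x y)
    by (no z≢x) (no z≢y) = trans (cong (transpose x y) eq) eq
      where
      eq : transpose x y z ≡ z
      eq = transpose-other z≢x z≢y

  transposition : A → A → FinPerm A
  transposition x y = record
    { perm        = mk↔ₛ′ (transpose x y) (transpose x y)
                      (transpose-involutive x y) (transpose-involutive x y)
    ; finiteMoved = x ∷ y ∷ [] , λ z∉ →
        transpose-other (λ eq → z∉ (here eq)) (λ eq → z∉ (there (here eq)))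
    }

module _ (em : EM) {A : Set a} (A-inf : Infinite A) where

  fresh : ∀ xs → ∃ λ (x : A) → x ∉ xs
  fresh xs = decidable-stable em λ ∄ →
    A-inf xs λ x → decidable-stable em λ x∉ → ∄ (x , x∉)

  distinct : ∀ n → ∃ λ (xs : List A) → length xs ≡ n × Unique xs
  distinct zero    = [] , refl , []
  distinct (suc n) =
    let (xs , len , u) = distinct n
        (x , x∉) = fresh xs
    in x ∷ xs , cong suc len , ¬Any⇒All¬ xs x∉ ∷ u

  -- Suppose `x` in `Z` lies outside `S`, and swap it with an atom `y` outside both `S` and `xs`.
  -- The swap fixes `S`, so it maps `Z` to itself and forces `y` into `xs`.
  finite⊆support : ∀ {S} (Z : FSSubset (Atoms A)) → ⟦ ℘fin A ⟧ Z →
                   InvariantSet._Supports_ (℘fs (Atoms A)) S Z → ⟦ Z ⟧ ⊆ (_∈ S)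
  finite⊆support {S} Z (lift (xs , Z⊆xs , _)) supp {x} x∈Z =
    decidable-stable em λ x∉S →
      let (y , y∉) = fresh (S ++ xs)
          fix : Fix S (transposition _≟_ x y)
          fix z∈S = transpose-other _≟_ (λ { refl → x∉S z∈S })
                                        (λ { refl → y∉ (∈-++⁺ˡ z∈S) })
          y∈Z : ⟦ Z ⟧ y
          y∈Z = proj₁ (supp (transposition _≟_ x y) fix)
                      (x , x∈Z , sym (transpose-left _≟_ x y))
      in y∉ (∈-++⁺ʳ S (Z⊆xs y∈Z))
    where
    _≟_ : DecidableEquality A
    _ ≟ _ = em

  module _ (Z : ℕ → Pred A ℓ) where
    open Traces Z

    -- Every set is homogeneous on a single point, and a list is a finite union of points.
    list-traces : ∀ xs → FinitelyManyTraces (_∈ xs)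
    list-traces []       = homogeneous-traces λ _ → inj₁ λ ()
    list-traces (x ∷ xs) = antitone split
      (∪-traces (homogeneous-traces singleton) (list-traces xs))
      where
      split : (_∈ x ∷ xs) ⊆ (_≡ x) ∪ (_∈ xs)
      split (here eq)  = inj₁ eq
      split (there y∈) = inj₂ y∈

      singleton : ∀ n → Homogeneous (_≡ x) n
      singleton n with em {P = Z n x}
      ... | yes x∈ = inj₁ λ { refl → x∈ }
      ... | no  x∉ = inj₂ λ { refl → x∉ }

  ℘fin-¬dedekind : ¬ DedekindInfinite (℘fin A)
  ℘fin-¬dedekind ded =
    let (m , n , m<n , Zm≐Zn) = Traces.traces-repeat (λ n → ⟦ term n ⟧)
          (λ n → finite⊆support (term n) (term∈ n) (supports n))
          (list-traces (λ n → ⟦ term n ⟧) support)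
    in <-irrefl (injective m n Zm≐Zn) m<n
    where open UniformSequence (dedekind⇒sequence em (℘fin A) ded)

-- The stages bound the length of a list of elements, which permutations preserve; `n + 1` distinct
-- atoms form a set outside stage `n`.
℘fin-ascending : EM → {A : Set a} → Infinite A → AscendingInfinite (℘fin A)
℘fin-ascending em {A} A-inf = uniform⇒ascending (℘fin A) bounded []
    (λ { n π _ (lift (xs , len , Z⊆xs , xs⊆Z)) → lift
         ( map (FinPerm.to π) xs
         , subst (_≤ n) (sym (length-map _ xs)) len
         , (λ { (z , z∈Z , refl) → ∈-map⁺ _ (Z⊆xs z∈Z) })
         , (λ y∈ → let (z , z∈xs , eq) = ∈-map⁻ _ y∈ in z , xs⊆Z z∈xs , eq)) })
    (λ { n (lift (xs , len , eq)) → lift (xs , m≤n⇒m≤1+n len , eq) })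
    (λ { (lift (xs , eq)) → length xs , lift (xs , ≤-refl , eq) })
    proper
  where
  bounded : ℕ → Subset (InvariantSet.permSet (℘fs (Atoms A)))
  bounded n = record
    { Mem  = λ Z → Lift _ (∃ λ (xs : List A) → length xs ≤ n × ⟦ Z ⟧ ≐ (_∈ xs))
    ; resp = λ (Y⊆Z , Z⊆Y) (lift (xs , len , Y⊆xs , xs⊆Y)) → lift
        (xs , len , (λ z∈Z → Y⊆xs (Z⊆Y z∈Z)) , (λ x∈ → Y⊆Z (xs⊆Y x∈)))
    }

  listed : List A → FSSubset (Atoms A)
  listed xs = closed⇒FSSubset xs
    (record { Mem = _∈ xs ; resp = λ { refl x∈ → x∈ } })
    (λ π fix x∈ → subst (_∈ xs) (sym (fix x∈)) x∈)

  proper : ∀ n → ¬ (⟦ ℘fin A ⟧ ⊆ Mem (bounded n))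
  proper n ⊆bounded =
    let (xs , len , u) = distinct em A-inf (suc n)
        lift (ys , ys≤n , xs⊆ys , _) =
          ⊆bounded {listed xs} (lift (xs , (λ x∈ → x∈) , (λ x∈ → x∈)))
    in <-irrefl refl (≤-trans (subst (_≤ length ys) len (unique-⊆⇒length-≤ u xs⊆ys)) ys≤n)

mainTheorem10 : ∀ {a c e} → (∀ {ℓ} → ExcludedMiddle ℓ) →
    (A : Set a) → Infinite A →
    (∀ (U : InvariantSet A c e) (X : FSSubset U) →
    (DedekindInfinite ℘fs[ X ] ⇔ AscendingInfinite X)
    × (DedekindInfinite X → AscendingInfinite X))
    × (¬ (∀ (U : InvariantSet A (lsuc a) a) (X : FSSubset U) →
    AscendingInfinite X → DedekindInfinite X))
    × AscendingInfinite (℘fin A)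
    × (¬ DedekindInfinite (℘fin A))
mainTheorem10 em A A-inf =
    (λ U X →
        mk⇔ (λ ded → subsets⇒ascending em X (dedekind⇒sequence em ℘fs[ X ] ded))
            (λ asc → sequence⇒dedekind em ℘fs[ X ] (ascending⇒subsets em X asc))
      , λ ded → sequence⇒ascending em X (dedekind⇒sequence em X ded))
  -- The counterexample lives in the invariant set `℘fs (Atoms A)`.
  , (λ converse → ℘fin-¬dedekind em A-inf
       (converse (℘fs (Atoms A)) (℘fin A) (℘fin-ascending em A-inf)))
  , ℘fin-ascending em A-inf
  , ℘fin-¬dedekind em A-inf
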